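{- Let $q$ be a prime power, $h\geq 2$, let $f:\mathbb{F}_{q^h}\to\mathbb{F}_q$ be a nonzero $\mathbb{F}_q$-linear functional, $\alpha\in\mathbb{F}_{q^h}\setminus\mathbb{F}_q$ and $\beta\in\mathbb{F}_{q^h}\setminus\{0\}$. Let $\mathcal{L}=\{(x:f(x)+y\alpha:y\beta): x\in\mathbb{F}_{q^h},\ y\in\mathbb{F}_q,\ (x,y)\neq(0,0)\}$ and let $\varphi$ be the collineation of $\mathrm{PG}(2,q^h)$ given by $(x:y:z)\mapsto(z:x:y)$. Suppose that (1) $f(\alpha/\beta)\neq 1$, and (2) for all $k\in\mathbb{F}_q$, $k\neq f\left(\frac{\alpha^2}{\beta}\right)+\left(f\left(\frac{\beta^2}{\alpha+k}\right)+k\right)f\left(\frac{\alpha}{\beta}\right)+k f\left(\frac{\beta^2}{\alpha+k}\right)f\left(\frac{1}{\beta}\right)$. Then $\mathcal{L}$ and $\varphi(\mathcal{L})$ are disjoint.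
   Context: Points of $\mathrm{PG}(2,q^h)$ are written in homogeneous coordinates $(a:b:c)$. -}

module Defs where

open import Level using (Level; _⊔_) renaming (suc to lsuc)
open import Algebra.Bundles using (CommutativeRing)
open import Algebra.Module.Bundles using (RawLeftModule)
open import Algebra.Module.Morphism.Structures using (module LeftModuleMorphisms)
open import Algebra.Morphism.Structures using (module RingMorphisms)
import Algebra.Module.Construct.TensorUnit as TensorUnit
open import Data.Fin.Base using (Fin)
open import Data.Nat.Base using (ℕ; _^_; _≤_)
open import Data.Nat.Primality using (Prime)
open import Data.Product.Base using (∃; ∃₂; Σ; _×_; _,_)
open import Function.Bundles using (Func; Inverse)
open import Relation.Binary.Bundles using (Setoid)
open import Relation.Binary.PropositionalEquality using (_≡_) renaming (setoid to ≡-setoid)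
open import Relation.Nullary.Negation using (¬_)
open import Relation.Unary using (Pred; _∈_)
import Relation.Binary.Reasoning.Setoid as SetoidReasoning

private
  variable
    c c₁ c₂ ℓ ℓ₁ ℓ₂ p : Level

IsPrimePower : ℕ → Set
IsPrimePower q = ∃₂ λ p n → Prime p × 1 ≤ n × q ≡ p ^ n

-- The inverse is a total operation; its value at 0# is unspecified.
record Field c ℓ : Set (lsuc (c ⊔ ℓ)) where
  field
    commutativeRing : CommutativeRing c ℓ

  open CommutativeRing commutativeRing public

  infix 8 _⁻¹
  infixl 7 _/_

  field
    0≉1        : 0# ≉ 1#
    _⁻¹        : Carrier → Carrier
    ⁻¹-cong    : ∀ {x y} → x ≈ y → x ⁻¹ ≈ y ⁻¹
    ⁻¹-inverse : ∀ x → x ≉ 0# → x * x ⁻¹ ≈ 1#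

  _/_ : Carrier → Carrier → Carrier
  x / y = x * y ⁻¹

  x*y≈0⇒x≈0 : ∀ {x y} → y ≉ 0# → x * y ≈ 0# → x ≈ 0#
  x*y≈0⇒x≈0 {x} {y} y≉0 xy≈0 = begin
    x               ≈⟨ *-identityʳ x ⟨
    x * 1#          ≈⟨ *-congˡ (⁻¹-inverse y y≉0) ⟨
    x * (y * y ⁻¹)  ≈⟨ *-assoc x y (y ⁻¹) ⟨
    x * y * y ⁻¹    ≈⟨ *-congʳ xy≈0 ⟩
    0# * y ⁻¹       ≈⟨ zeroˡ (y ⁻¹) ⟩
    0#              ∎
    where open SetoidReasoning setoid

HasOrder : Field c ℓ → ℕ → Set (c ⊔ ℓ)
HasOrder K n = Inverse (Field.setoid K) (≡-setoid (Fin n))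

-- F regarded as a subfield of K through the embedding ι.
record FieldExtension (F : Field c₁ ℓ₁) (K : Field c₂ ℓ₂) : Set (c₁ ⊔ ℓ₁ ⊔ c₂ ⊔ ℓ₂) where
  private
    module F = Field F
    module K = Field K
  open RingMorphisms F.rawRing K.rawRing using (IsRingMonomorphism)

  field
    ι                  : F.Carrier → K.Carrier
    isRingMonomorphism : IsRingMonomorphism ι

  open RingMorphisms.IsRingMonomorphism isRingMonomorphism public

  rawLeftModule : RawLeftModule F.Carrier c₂ ℓ₂
  rawLeftModule = record
    { Carrierᴹ = K.Carrier
    ; _≈ᴹ_     = K._≈_
    ; _+ᴹ_     = K._+_
    ; _*ₗ_     = λ a x → ι a K.* x
    ; 0ᴹ       = K.0#
    ; -ᴹ_      = K.-_
    }

  IsLinearFunctional : (K.Carrier → F.Carrier) → Set (c₁ ⊔ ℓ₁ ⊔ c₂ ⊔ ℓ₂)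
  IsLinearFunctional =
    LeftModuleMorphisms.IsLeftModuleHomomorphism
      rawLeftModule (TensorUnit.rawLeftModule {R = F.rawRing})

-- The points of PG(2,K): nonzero coordinate triples up to a nonzero scalar.
module ProjectivePlane (K : Field c ℓ) where
  open Field K

  infix 4 _∼_

  record Point : Set (c ⊔ ℓ) where
    constructor point
    field
      X Y Z   : Carrier
      nonzero : ¬ (X ≈ 0# × Y ≈ 0# × Z ≈ 0#)

  _∼_ : Point → Point → Set (c ⊔ ℓ)
  P ∼ Q = ∃ λ s → s ≉ 0# × P.X ≈ s * Q.X × P.Y ≈ s * Q.Y × P.Z ≈ s * Q.Z
    where
    module P = Point P
    module Q = Point Q

  private
    ∼-refl : ∀ {P} → P ∼ P
    ∼-refl = 1# , (λ 1≈0 → 0≉1 (sym 1≈0)) , e , e , e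
      where
      e : ∀ {x} → x ≈ 1# * x
      e {x} = sym (*-identityˡ x)

    ∼-trans : ∀ {P Q R} → P ∼ Q → Q ∼ R → P ∼ R
    ∼-trans (s , s≉0 , p₁ , p₂ , p₃) (t , t≉0 , q₁ , q₂ , q₃) =
      s * t , (λ st≈0 → s≉0 (x*y≈0⇒x≈0 t≉0 st≈0)) , e p₁ q₁ , e p₂ q₂ , e p₃ q₃
      where
      e : ∀ {x y z} → x ≈ s * y → y ≈ t * z → x ≈ s * t * z
      e {x} {y} {z} p q = trans p (trans (*-congˡ q) (sym (*-assoc s t z)))

    ∼-sym : ∀ {P Q} → P ∼ Q → Q ∼ P
    ∼-sym (s , s≉0 , p₁ , p₂ , p₃) = s ⁻¹ , s⁻¹≉0 , e p₁ , e p₂ , e p₃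
      where
      s⁻¹≉0 : s ⁻¹ ≉ 0#
      s⁻¹≉0 s⁻¹≈0 =
        0≉1 (trans (sym (zeroʳ s)) (trans (*-congˡ (sym s⁻¹≈0)) (⁻¹-inverse s s≉0)))

      e : ∀ {x y} → x ≈ s * y → y ≈ s ⁻¹ * x
      e {x} {y} p = begin
        y               ≈⟨ *-identityˡ y ⟨
        1# * y          ≈⟨ *-congʳ (⁻¹-inverse s s≉0) ⟨
        s * s ⁻¹ * y    ≈⟨ *-congʳ (*-comm s (s ⁻¹)) ⟩
        s ⁻¹ * s * y    ≈⟨ *-assoc (s ⁻¹) s y ⟩
        s ⁻¹ * (s * y)  ≈⟨ *-congˡ p ⟨
        s ⁻¹ * x        ∎
        where open SetoidReasoning setoid

  PG : Setoid (c ⊔ ℓ) (c ⊔ ℓ)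
  PG = record
    { Carrier       = Point
    ; _≈_           = _∼_
    ; isEquivalence = record
      { refl  = λ {P} → ∼-refl {P}
      ; sym   = λ {P Q} → ∼-sym {P} {Q}
      ; trans = λ {P Q R} → ∼-trans {P} {Q} {R}
      }
    }

  Image : Func PG PG → Pred Point p → Pred Point (c ⊔ ℓ ⊔ p)
  Image g S P = ∃ λ Q → Q ∈ S × P ∼ Func.to g Q

  φ : Func PG PG
  φ = record
    { to   = λ { (point x y z n) → point z x y (λ (z≈0 , x≈0 , y≈0) → n (x≈0 , y≈0 , z≈0)) }
    ; cong = λ (s , s≉0 , p₁ , p₂ , p₃) → s , s≉0 , p₃ , p₁ , p₂
    }

module _ {F : Field c₁ ℓ₁} {K : Field c₂ ℓ₂} (E : FieldExtension F K) where
  private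
    module F = Field F
  open Field K
  open FieldExtension E
  open ProjectivePlane K

  𝓛-point : (f : Carrier → F.Carrier) (α β : Carrier) → β ≉ 0# →
            (x : Carrier) (y : F.Carrier) → ¬ (x ≈ 0# × y F.≈ F.0#) → Point
  𝓛-point f α β β≉0 x y xy≉0 =
    point x (ι (f x) + ι y * α) (ι y * β)
      λ (x≈0 , _ , yβ≈0) →
        xy≉0 (x≈0 , injective (trans (x*y≈0⇒x≈0 β≉0 yβ≈0) (sym 0#-homo)))

  𝓛 : (f : Carrier → F.Carrier) (α β : Carrier) → β ≉ 0# → Pred Point (c₁ ⊔ ℓ₁ ⊔ c₂ ⊔ ℓ₂)
  𝓛 f α β β≉0 P =
    ∃₂ λ x y → Σ (¬ (x ≈ 0# × y F.≈ F.0#)) λ xy≉0 → P ∼ 𝓛-point f α β β≉0 x y xy≉0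

{-# OPTIONS --safe #-}
-- A common point of 𝓛 and φ(𝓛) gives (x,y), (u,v) and a scalar s ≠ 0 with
--   x = s v β,   f(x) + y α = s u,   y β = s (f(u) + v α).
-- If v = 0 then x = 0 and u = f(u) α/β with f(u) ≠ 0, so f(α/β) = 1.
-- If v ≠ 0 then y ≠ 0 because α ∉ F, and rescaling gives y = v = 1.  With k = f(u) the
-- equations then say x = β²/(α + k) and u = (f(x) + α)(α + k)/β; applying f to the latter
-- contradicts (2) at k.
module Submission where

open import Defs
open import Level using (Level)
open import Data.Nat.Base using (ℕ; _^_; _≤_)
open import Relation.Nullary.Negation using (¬_)
open import Relation.Unary using (_⊥_)
open import Algebra.Module.Morphism.Structures using (module LeftModuleMorphisms)
import Algebra.Module.Construct.TensorUnit as TensorUnit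
import Algebra.Properties.Ring as RingProperties
import Algebra.Solver.Ring.NaturalCoefficients.Default as SemiringSolver
import Data.Empty as Empty
open import Data.Product.Base using (_×_; _,_)
open import Function.Bundles using (Func)
open import Relation.Binary.Bundles using (Setoid)
import Relation.Binary.Reasoning.Setoid as SetoidReasoning

module FieldProperties {c ℓ : Level} (K : Field c ℓ) where
  open Field K
  open SetoidReasoning setoid

  ⁻¹-inverseˡ : ∀ {x} → x ≉ 0# → x ⁻¹ * x ≈ 1#
  ⁻¹-inverseˡ {x} x≉0 = trans (*-comm (x ⁻¹) x) (⁻¹-inverse x x≉0)

  *-cancelˡ-nonZero : ∀ {a x y} → a ≉ 0# → a * x ≈ a * y → x ≈ y
  *-cancelˡ-nonZero {a} {x} {y} a≉0 ax≈ay = begin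
    x               ≈⟨ lemma x ⟨
    a ⁻¹ * (a * x)  ≈⟨ *-congˡ ax≈ay ⟩
    a ⁻¹ * (a * y)  ≈⟨ lemma y ⟩
    y               ∎
    where
    lemma : ∀ z → a ⁻¹ * (a * z) ≈ z
    lemma z = begin
      a ⁻¹ * (a * z)  ≈⟨ *-assoc (a ⁻¹) a z ⟨
      a ⁻¹ * a * z    ≈⟨ *-congʳ (⁻¹-inverseˡ a≉0) ⟩
      1# * z          ≈⟨ *-identityˡ z ⟩
      z               ∎

  *-nonZero : ∀ {x y} → x ≉ 0# → y ≉ 0# → x * y ≉ 0#
  *-nonZero x≉0 y≉0 xy≈0 = x≉0 (x*y≈0⇒x≈0 y≉0 xy≈0)

module LinearFunctional
  {c₁ ℓ₁ c₂ ℓ₂ : Level} {F : Field c₁ ℓ₁} {K : Field c₂ ℓ₂} (E : FieldExtension F K)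
  (f : Field.Carrier K → Field.Carrier F)
  (f-linear : FieldExtension.IsLinearFunctional E f)
  where

  private
    module F = Field F
  open Field K
  open FieldExtension E
  open LeftModuleMorphisms.IsLeftModuleHomomorphism {M₁ = rawLeftModule}
    {M₂ = TensorUnit.rawLeftModule {R = F.rawRing}} f-linear public
    using ()
    renaming (⟦⟧-cong to f-cong; +ᴹ-homo to f-+; *ₗ-homo to f-*; 0ᴹ-homo to f-0)

  private
    module FP = FieldProperties F
    module KP = FieldProperties K
    module R = SetoidReasoning setoid
  open SemiringSolver commutativeSemiring using (solve; _:=_; _:+_; _:*_)

  ι-nonZero : ∀ {a} → a F.≉ F.0# → ι a ≉ 0#
  ι-nonZero a≉0 ιa≈0 = a≉0 (injective (trans ιa≈0 (sym 0#-homo)))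

  ι-inverseˡ : ∀ {a} → a F.≉ F.0# → ι (a F.⁻¹) * ι a ≈ 1#
  ι-inverseˡ {a} a≉0 = begin
    ι (a F.⁻¹) * ι a  ≈⟨ *-homo (a F.⁻¹) a ⟨
    ι (a F.⁻¹ F.* a)  ≈⟨ ⟦⟧-cong (FP.⁻¹-inverseˡ a≉0) ⟩
    ι F.1#            ≈⟨ 1#-homo ⟩
    1#                ∎
    where open R

  ι-f-* : ∀ a x → ι (f (ι a * x)) ≈ ι a * ι (f x)
  ι-f-* a x = trans (⟦⟧-cong (f-* a x)) (*-homo a (f x))

  -- Otherwise α = -a/b would lie in the subfield. This is how α ∉ F enters the argument.
  a+bα-nonZero : ∀ {α} → (∀ a → α ≉ ι a) → ∀ {a b} → b F.≉ F.0# → ι a + ι b * α ≉ 0#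
  a+bα-nonZero {α} α∉F {a} {b} b≉0 a+bα≈0 =
    α∉F (b F.⁻¹ F.* (F.- a)) (KP.*-cancelˡ-nonZero (ι-nonZero b≉0) (begin
      ι b * α                               ≈⟨ +-inverseʳ-unique (ι a) (ι b * α) a+bα≈0 ⟩
      - ι a                                 ≈⟨ -‿homo a ⟨
      ι (F.- a)                             ≈⟨ *-identityˡ _ ⟨
      1# * ι (F.- a)                        ≈⟨ *-congʳ (ι-inverseˡ b≉0) ⟨
      ι (b F.⁻¹) * ι b * ι (F.- a)          ≈⟨ *-congʳ (*-comm _ _) ⟩
      ι b * ι (b F.⁻¹) * ι (F.- a)          ≈⟨ *-assoc _ _ _ ⟩
      ι b * (ι (b F.⁻¹) * ι (F.- a))        ≈⟨ *-congˡ (*-homo _ _) ⟨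
      ι b * ι (b F.⁻¹ F.* (F.- a))          ∎))
    where
    open R
    open RingProperties ring using (+-inverseʳ-unique)

  -- The hypotheses are what the last two coordinate equations become when v = 0 and x = 0.
  -- Eliminating s gives u = f(u) α/β with f(u) in F, so applying f gives f(u) = f(u) f(α/β), and
  -- f(u) can be cancelled.
  v≈0⇒f[α/β]≈1 : ∀ {α β} → β ≉ 0# → ∀ {s y u} → y F.≉ F.0# →
    ι y * α ≈ s * u → ι y * β ≈ s * ι (f u) → f (α / β) F.≈ F.1#
  v≈0⇒f[α/β]≈1 {α} {β} β≉0 {s} {y} {u} y≉0 yα≈su yβ≈sfu =
    FP.*-cancelˡ-nonZero fu≉0 (F.trans (F.sym fu≈) (F.sym (F.*-identityʳ (f u))))
    where
    open R
    fu≉0 : f u F.≉ F.0#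
    fu≉0 fu≈0 = KP.*-nonZero (ι-nonZero y≉0) β≉0 (begin
      ι y * β      ≈⟨ yβ≈sfu ⟩
      s * ι (f u)  ≈⟨ *-congˡ (trans (⟦⟧-cong fu≈0) 0#-homo) ⟩
      s * 0#       ≈⟨ zeroʳ s ⟩
      0#           ∎)

    -- Cross-multiplying the two equations makes s disappear; the common factor y is then cancelled.
    uβ≈ : u * β ≈ ι (f u) * α
    uβ≈ = KP.*-cancelˡ-nonZero (ι-nonZero y≉0) (begin
      ι y * (u * β)        ≈⟨ solve 3 (λ a b c → a :* (b :* c) := b :* (a :* c)) refl (ι y) u β ⟩
      u * (ι y * β)        ≈⟨ *-congˡ yβ≈sfu ⟩
      u * (s * ι (f u))    ≈⟨ solve 3 (λ a b c → a :* (b :* c) := c :* (b :* a)) refl u s (ι (f u)) ⟩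
      ι (f u) * (s * u)    ≈⟨ *-congˡ yα≈su ⟨
      ι (f u) * (ι y * α)  ≈⟨ solve 3 (λ a b c → a :* (b :* c) := b :* (a :* c)) refl (ι (f u)) (ι y) α ⟩
      ι y * (ι (f u) * α)  ∎)

    fu≈ : f u F.≈ f u F.* f (α / β)
    fu≈ = F.trans (f-cong (begin
      u                   ≈⟨ *-identityʳ u ⟨
      u * 1#              ≈⟨ *-congˡ (⁻¹-inverse β β≉0) ⟨
      u * (β * β ⁻¹)      ≈⟨ *-assoc _ _ _ ⟨
      u * β * β ⁻¹        ≈⟨ *-congʳ uβ≈ ⟩
      ι (f u) * α * β ⁻¹  ≈⟨ *-assoc _ _ _ ⟩
      ι (f u) * (α / β)   ∎)) (f-* (f u) (α / β))

  -- This is the normalised system y = v = 1. The last equation says μ = β/(α + k), which fixes x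
  -- and then expresses u through α, β, k and w = f(x). The resulting u is an F-linear combination
  -- of α²/β, α/β and 1/β, so f can be evaluated on it term by term.
  y≈v≈1⇒k-equation : ∀ {α β} → β ≉ 0# → ∀ {μ x u} →
    x ≈ μ * β → ι (f x) + α ≈ μ * u → β ≈ μ * (ι (f u) + α) →
    let k = f u; w = f ((β * β) / (α + ι k)) in
    k F.≈ f ((α * α) / β) F.+ (w F.+ k) F.* f (α / β) F.+ k F.* w F.* f (1# / β)
  y≈v≈1⇒k-equation {α} {β} β≉0 {μ} {x} {u} x≈ fx+α≈ β≈ = F.trans (f-cong u≈) f-expand
    where
    open R
    k = f u
    g = α + ι k
    w = f ((β * β) / g)
    b = β ⁻¹

    β≈μg : β ≈ μ * g
    β≈μg = trans β≈ (*-congˡ (+-comm (ι k) α))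

    -- As β = μ g is nonzero, the quotient by α + k is a genuine one, not the unspecified value of
    -- the inverse at zero.
    g≉0 : g ≉ 0#
    g≉0 g≈0 = β≉0 (trans β≈μg (trans (*-congˡ g≈0) (zeroʳ μ)))

    x≈β²/g : x ≈ (β * β) / g
    x≈β²/g = begin
      x                     ≈⟨ x≈ ⟩
      μ * β                 ≈⟨ *-identityʳ _ ⟨
      μ * β * 1#            ≈⟨ *-congˡ (⁻¹-inverse g g≉0) ⟨
      μ * β * (g * g ⁻¹)    ≈⟨ solve 4 (λ m b g h → m :* b :* (g :* h) := m :* g :* b :* h) refl μ β g (g ⁻¹) ⟩
      μ * g * β * g ⁻¹      ≈⟨ *-congʳ (*-congʳ β≈μg) ⟨
      β * β * g ⁻¹          ∎

    u≈ : u ≈ (α * α) / β + ι (w F.+ k) * (α / β) + ι (k F.* w) * (1# / β)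
    u≈ = begin
      u                            ≈⟨ *-identityʳ u ⟨
      u * 1#                       ≈⟨ *-congˡ (⁻¹-inverse β β≉0) ⟨
      -- Writing β as μ g brings out the factor μ u, which the second equation turns into f(x) + α.
      u * (β * b)                  ≈⟨ *-congˡ (*-congʳ β≈μg) ⟩
      u * (μ * g * b)              ≈⟨ solve 4 (λ u m g b → u :* (m :* g :* b) := m :* u :* g :* b) refl u μ g b ⟩
      μ * u * g * b                ≈⟨ *-congʳ (*-congʳ fx+α≈) ⟨
      (ι (f x) + α) * g * b        ≈⟨ *-congʳ (*-congʳ (+-congʳ (⟦⟧-cong (f-cong x≈β²/g)))) ⟩
      (ι w + α) * g * b            ≈⟨ solve 4 (λ w a k b → (w :+ a) :* (a :+ k) :* b
                                        := a :* a :* b :+ (w :+ k) :* (a :* b) :+ k :* w :* b)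
                                        refl (ι w) α (ι k) b ⟩
      (α * α) / β + (ι w + ι k) * (α / β) + ι k * ι w * b
        ≈⟨ +-cong (+-congˡ (*-congʳ (+-homo w k))) (*-cong (*-homo k w) (*-identityˡ b)) ⟨
      (α * α) / β + ι (w F.+ k) * (α / β) + ι (k F.* w) * (1# / β) ∎

    f-expand : f ((α * α) / β + ι (w F.+ k) * (α / β) + ι (k F.* w) * (1# / β))
      F.≈ f ((α * α) / β) F.+ (w F.+ k) F.* f (α / β) F.+ k F.* w F.* f (1# / β)
    f-expand = F.trans (f-+ _ _)
      (F.+-cong (F.trans (f-+ _ _) (F.+-congˡ (f-* _ _))) (f-* _ _))

  -- The last three hypotheses equate (x : f(x) + yα : yβ), coordinate by coordinate, with s times
  -- (vβ : u : f(u) + vα), the image under `φ` of the point with parameters (u, v).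
  module _ {α β : Carrier} (α∉F : ∀ a → α ≉ ι a) (β≉0 : β ≉ 0#)
    (fα/β≉1 : f (α / β) F.≉ F.1#)
    (no-k : ∀ k → k F.≉ f ((α * α) / β)
            F.+ (f ((β * β) / (α + ι k)) F.+ k) F.* f (α / β)
            F.+ k F.* f ((β * β) / (α + ι k)) F.* f (1# / β))
    {s x u : Carrier} {y v : F.Carrier} (s≉0 : s ≉ 0#) (xy≉0 : ¬ (x ≈ 0# × y F.≈ F.0#))
    (x≈ : x ≈ s * (ι v * β)) (fx+yα≈ : ι (f x) + ι y * α ≈ s * u)
    (yβ≈ : ι y * β ≈ s * (ι (f u) + ι v * α))
    where
    open R

    -- Here x = s v β = 0, which forces y ≠ 0 and removes f(x) from the second equation.
    v≈0⇒⊥ : v F.≈ F.0# → Empty.⊥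
    v≈0⇒⊥ v≈0 = fα/β≉1 (v≈0⇒f[α/β]≈1 β≉0 (λ y≈0 → xy≉0 (x≈0 , y≈0)) yα≈su yβ≈sfu)
      where
      v*≈0 : ∀ z → ι v * z ≈ 0#
      v*≈0 z = trans (*-congʳ (trans (⟦⟧-cong v≈0) 0#-homo)) (zeroˡ z)

      x≈0 : x ≈ 0#
      x≈0 = trans x≈ (trans (*-congˡ (v*≈0 β)) (zeroʳ s))

      yα≈su : ι y * α ≈ s * u
      yα≈su = begin
        ι y * α              ≈⟨ +-identityˡ _ ⟨
        0# + ι y * α         ≈⟨ +-congʳ (trans (⟦⟧-cong (F.trans (f-cong x≈0) f-0)) 0#-homo) ⟨
        ι (f x) + ι y * α    ≈⟨ fx+yα≈ ⟩
        s * u                ∎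

      yβ≈sfu : ι y * β ≈ s * ι (f u)
      yβ≈sfu = trans yβ≈ (*-congˡ (trans (+-congˡ (v*≈0 α)) (+-identityʳ _)))

    v≉0⇒⊥ : v F.≉ F.0# → Empty.⊥
    v≉0⇒⊥ v≉0 = no-k (f u′) (y≈v≈1⇒k-equation β≉0 x′≈ fx′+α≈ β≈)
      where
      -- If y = 0, the third equation makes s (f(u) + vα) vanish, although both factors are nonzero.
      y≉0 : y F.≉ F.0#
      y≉0 y≈0 = KP.*-nonZero s≉0 (a+bα-nonZero α∉F v≉0)
        (trans (sym yβ≈) (trans (*-congʳ (trans (⟦⟧-cong y≈0) 0#-homo)) (zeroˡ β)))

      -- Dividing (x, y) by y and (u, v) by v changes the scalar s into s v / y. Since y and v lie
      -- in F, these divisions commute with f, so the equations keep their shape.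
      y⁻¹ = ι (y F.⁻¹)
      v⁻¹ = ι (v F.⁻¹)
      μ = y⁻¹ * s * ι v
      x′ = y⁻¹ * x
      u′ = v⁻¹ * u

      y⁻¹*y* : ∀ z → y⁻¹ * (ι y * z) ≈ z
      y⁻¹*y* z = trans (sym (*-assoc _ _ _)) (trans (*-congʳ (ι-inverseˡ y≉0)) (*-identityˡ z))

      v⁻¹*v* : ∀ z → v⁻¹ * ι v * z ≈ z
      v⁻¹*v* z = trans (*-congʳ (ι-inverseˡ v≉0)) (*-identityˡ z)

      x′≈ : x′ ≈ μ * β
      x′≈ = trans (*-congˡ x≈)
        (solve 4 (λ p s v b → p :* (s :* (v :* b)) := p :* s :* v :* b) refl y⁻¹ s (ι v) β)

      fx′+α≈ : ι (f x′) + α ≈ μ * u′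
      fx′+α≈ = begin
        ι (f x′) + α                         ≈⟨ +-cong (ι-f-* _ x) (sym (y⁻¹*y* α)) ⟩
        y⁻¹ * ι (f x) + y⁻¹ * (ι y * α)      ≈⟨ distribˡ _ _ _ ⟨
        y⁻¹ * (ι (f x) + ι y * α)            ≈⟨ *-congˡ fx+yα≈ ⟩
        y⁻¹ * (s * u)                        ≈⟨ v⁻¹*v* _ ⟨
        v⁻¹ * ι v * (y⁻¹ * (s * u))          ≈⟨ solve 5 (λ q v p s u → q :* v :* (p :* (s :* u))
                                                  := p :* s :* v :* (q :* u)) refl v⁻¹ (ι v) y⁻¹ s u ⟩
        μ * u′                               ∎

      β≈ : β ≈ μ * (ι (f u′) + α)
      β≈ = begin
        β                                    ≈⟨ y⁻¹*y* β ⟨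
        y⁻¹ * (ι y * β)                      ≈⟨ *-congˡ yβ≈ ⟩
        y⁻¹ * (s * (ι (f u) + ι v * α))      ≈⟨ *-congˡ (*-congˡ (+-congʳ (v⁻¹*v* _))) ⟨
        y⁻¹ * (s * (v⁻¹ * ι v * ι (f u) + ι v * α))
          ≈⟨ solve 6 (λ p s q v k a → p :* (s :* (q :* v :* k :+ v :* a))
               := p :* s :* v :* (q :* k :+ a)) refl y⁻¹ s v⁻¹ (ι v) (ι (f u)) α ⟩
        μ * (v⁻¹ * ι (f u) + α)              ≈⟨ *-congˡ (+-congʳ (ι-f-* _ u)) ⟨
        μ * (ι (f u′) + α)                   ∎

    no-common-point : Empty.⊥
    -- The first case is itself a proof of v ≠ 0, so feeding it to the second settles both without
    -- deciding equality in F.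
    no-common-point = v≉0⇒⊥ v≈0⇒⊥

theorem4p1 : ∀ {c₁ ℓ₁ c₂ ℓ₂ : Level} (q h : ℕ) → IsPrimePower q → 2 ≤ h →
    (F : Field c₁ ℓ₁) (K : Field c₂ ℓ₂) → HasOrder F q → HasOrder K (q ^ h) →
    (E : FieldExtension F K) →
    let module F = Field F
        module K = Field K
        open FieldExtension E
        open ProjectivePlane K
    in
    (f : K.Carrier → F.Carrier) → IsLinearFunctional f → ¬ (∀ x → f x F.≈ F.0#) →
    (α : K.Carrier) → (∀ a → α K.≉ ι a) →
    (β : K.Carrier) (β≉0 : β K.≉ K.0#) →
    f (α K./ β) F.≉ F.1# →
    (∀ (k : F.Carrier) →
      k F.≉ f ((α K.* α) K./ β)
            F.+ (f ((β K.* β) K./ (α K.+ ι k)) F.+ k) F.* f (α K./ β)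
            F.+ k F.* f ((β K.* β) K./ (α K.+ ι k)) F.* f (K.1# K./ β)) →
    𝓛 E f α β β≉0 ⊥ Image φ (𝓛 E f α β β≉0)
theorem4p1 _ _ _ _ F K _ _ E f f-linear _ α α∉F β β≉0 fα/β≉1 no-k {P}
  ((x , y , xy≉0 , P∼A) , (Q , (u , v , uv≉0 , Q∼B) , P∼φQ)) =
  let A = 𝓛-point E f α β β≉0 x y xy≉0
      B = 𝓛-point E f α β β≉0 u v uv≉0
      φQ = Func.to φ Q
      φB = Func.to φ B
      -- P and Q are given only up to scalars. The chain A ∼ P ∼ φ(Q) ∼ φ(B) merges these into a
      -- single s relating the explicit coordinates of A and φ(B).
      (s , s≉0 , eX , eY , eZ) =
        PG.trans {A} {P} {φB} (PG.sym {P} {A} P∼A)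
          (PG.trans {P} {φQ} {φB} P∼φQ (Func.cong φ {Q} {B} Q∼B))
  in no-common-point α∉F β≉0 fα/β≉1 no-k s≉0 xy≉0 eX eY eZ
  where
  open ProjectivePlane K
  module PG = Setoid PG
  open LinearFunctional E f f-linear using (no-common-point)
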